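{- If $G$ is a connected graph on at most $9$ vertices, then $c(G)\leq 2$.
   Context: Game of cops and robbers on a connected graph $G$: first $k$ cops are placed on vertices (several cops may share a vertex), then the robber is placed on a vertex; then cops and robber alternate moves, the cops moving first. On the cops' turn each cop moves to a neighboring vertex or stays put; on the robber's turn he does likewise. All positions are always known to all players. The cops win if at some finite time a cop occupies the same vertex as the robber. The cop number $c(G)$ is the minimum $k$ such that $k$ cops have a strategy that wins against every robber strategy. -}

module Defs where

open import Data.Nat using (ℕ; _≤_)
open import Data.Fin using (Fin)
open import Data.Bool using (Bool; T)
open import Data.Product using (Σ; ∃; _×_; Σ-syntax)
open import Data.Sum using (_⊎_)
open import Relation.Nullary using (¬_)
open import Relation.Binary.PropositionalEquality using (_≡_)
open import Relation.Binary.Construct.Closure.ReflexiveTransitive using (Star)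

record Graph (n : ℕ) : Set where
  field
    edge  : Fin n → Fin n → Bool
    sym   : ∀ u v → T (edge u v) → T (edge v u)
    irrefl : ∀ v → ¬ T (edge v v)

  Adj : Fin n → Fin n → Set
  Adj u v = T (edge u v)

open Graph public

Connected : ∀ {n} → Graph n → Set
Connected {n} G = ∀ (u v : Fin n) → Star (Adj G) u v

Step : ∀ {n} → Graph n → Fin n → Fin n → Set
Step G u v = (v ≡ u) ⊎ Adj G u v

Cops : ℕ → ℕ → Set
Cops k n = Fin k → Fin n

CopsMove : ∀ {n k} → Graph n → Cops k n → Cops k n → Set
CopsMove G c c' = ∀ i → Step G (c i) (c' i)

Caught : ∀ {n k} → Cops k n → Fin n → Set
Caught {k = k} c r = Σ[ i ∈ Fin k ] c i ≡ r

-- CopsWinFrom G c r : with cops at c and robber at r, and the cops to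
-- move, the cops can force capture in finitely many moves (inductive,
-- well-founded game tree = winning strategy against every robber strategy).
data CopsWinFrom {n k : ℕ} (G : Graph n) : Cops k n → Fin n → Set where
  caught : ∀ {c r} → Caught c r → CopsWinFrom G c r
  move   : ∀ {c r} (c' : Cops k n) → CopsMove G c c' →
           (Caught c' r ⊎ (∀ r' → Step G r r' → CopsWinFrom G c' r')) →
           CopsWinFrom G c r

CopsWin : ∀ {n} → Graph n → ℕ → Set
CopsWin {n} G k = Σ[ c ∈ Cops k n ] (∀ r → CopsWinFrom G c r)

-- c(G) ≤ m  (c(G) is the least k with CopsWin G k).
CopNumber≤ : ∀ {n} → Graph n → ℕ → Set
CopNumber≤ G m = Σ[ k ∈ ℕ ] (k ≤ m × CopsWin G k)

{-# OPTIONS --safe #-}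
module Submission where

-- Induct on the number of vertices. If N(u) ⊆ N[v] for some u ≠ v, the graph retracts onto
-- G − u; two cops that win there catch the robber's image in G, and if he is then on u, one
-- cop holds him there from v while the other walks to u. If some G − N[v] is
-- dismantlable componentwise, one cop stays on v forever and the other catches the robber in
-- his component. Apart from K₃ □ K₃, where an explicit two-move trap works, every connected
-- graph on at most nine vertices is of one of these two kinds. This is checked by a search
-- over partially known graphs: vertex 0 has maximum degree, edges are decided one at a time,
-- and vertices that look alike so far may be exchanged.

open import Defs hiding (sym)
open import Data.Bool using (Bool; true; false; T; if_then_else_; _∨_; _∧_)
import Data.Bool.Properties as Bool
open import Data.Empty using (⊥)
open import Data.Fin using (Fin; zero; suc; punchIn; punchOut)
open import Data.Fin.Permutation
  using (Permutation′; _⟨$⟩ʳ_; _⟨$⟩ˡ_; inverseˡ; inverseʳ; transpose)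
open import Data.Fin.Properties
  using (_≟_; any?; all?; punchIn-injective; punchIn-punchOut; punchInᵢ≢i)
open import Data.List as List using (List; []; _∷_; filter; allFin; cartesianProduct; _++_)
open import Data.List.Membership.Propositional using (_∈_; find)
open import Data.List.Membership.Propositional.Properties using (∈-filter⁺; ∈-allFin)
import Data.List.Relation.Unary.All as All
import Data.List.Relation.Unary.Any as Any
open import Data.Maybe using (Maybe; just; nothing)
open import Data.Maybe.Properties using (≡-dec)
open import Data.Nat using (ℕ; zero; suc; _≤_; _<_; z≤n; s≤s; _<?_)
open import Data.Nat.Properties
  using (+-0-commutativeMonoid; +-mono-≤; ≤-refl; ≤-trans; <⇒≤; <⇒≱; ≤-totalOrder)
open import Data.Product using (∃; ∃₂; _×_; _,_; proj₁; proj₂)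
open import Data.Sum using (_⊎_; inj₁; inj₂; [_,_]′)
open import Data.Unit using (⊤; tt)
open import Data.Vec using (Vec; lookup; tabulate)
open import Data.Vec.Functional using (updateAt)
open import Data.Vec.Functional.Properties using (updateAt-updates; updateAt-minimal)
open import Data.Vec.Properties using (lookup∘tabulate)
open import Function using (_∘_; const)
open import Relation.Binary.Construct.Closure.ReflexiveTransitive using (Star; ε; _◅_; gmap)
open import Relation.Binary.PropositionalEquality
  using (_≡_; _≢_; refl; sym; trans; cong; cong₂; subst; subst₂; ≢-sym)
open import Relation.Nullary using (¬_; Dec; yes; no; does; contradiction)
open import Relation.Nullary.Decidable using (T?; ¬?; _×-dec_; _⊎-dec_; _→-dec_)

open import Algebra.Properties.CommutativeMonoid.Sum +-0-commutativeMonoid using (sum; sum-permute)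
open import Data.List.Extrema ≤-totalOrder using (argmax; f[xs]≤f[argmax])

-- Steps, symmetry of adjacency, capture

private
  variable
    n k : ℕ

witness : {A : Set} (a? : Dec A) → T (does a?) → A
witness (yes a) _ = a

step-sym : (G : Graph n) → ∀ {x y} → Step G x y → Step G y x
step-sym G (inj₁ eq)  = inj₁ (sym eq)
step-sym G (inj₂ adj) = inj₂ (Graph.sym G _ _ adj)

edge-comm : (G : Graph n) → ∀ x y → edge G x y ≡ edge G y x
edge-comm G x y with edge G x y in e | edge G y x in f
... | true  | true  = refl
... | false | false = refl
... | true  | false = contradiction (Graph.sym G x y (subst T (sym e) _)) (subst T f)
... | false | true  = contradiction (Graph.sym G y x (subst T (sym f) _)) (subst T e)

edge-irrefl : (G : Graph n) → ∀ x → edge G x x ≡ false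
edge-irrefl G x with edge G x x in e
... | false = refl
... | true  = contradiction (subst T (sym e) _) (irrefl G x)

moveOne : (G : Graph n) (c : Cops k n) (i : Fin k) {x : Fin n} →
          Step G (c i) x → CopsMove G c (updateAt c i (const x))
moveOne G c i s j with j ≟ i
... | yes refl = subst (Step G (c i)) (sym (updateAt-updates i c)) s
... | no j≢i   = inj₁ (updateAt-minimal j i c j≢i)

capture : (G : Graph n) (c : Cops k n) (i : Fin k) {r : Fin n} →
          Step G (c i) r → CopsWinFrom G c r
capture G c i s = move _ (moveOne G c i s) (inj₁ (i , updateAt-updates i c))

-- Relabelling

relabel : Permutation′ n → Graph n → Graph n
relabel π G = record
  { edge   = λ x y → edge G (π ⟨$⟩ʳ x) (π ⟨$⟩ʳ y)
  ; sym    = λ x y → Graph.sym G (π ⟨$⟩ʳ x) (π ⟨$⟩ʳ y)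
  ; irrefl = λ x → irrefl G (π ⟨$⟩ʳ x)
  }

module _ (π : Permutation′ n) (G : Graph n) where

  private
    unlabel : ∀ {x y} → Adj G x y → Adj (relabel π G) (π ⟨$⟩ˡ x) (π ⟨$⟩ˡ y)
    unlabel = subst₂ (Adj G) (sym (inverseʳ π)) (sym (inverseʳ π))

  relabel-step⁺ : ∀ {x y} → Step (relabel π G) x y → Step G (π ⟨$⟩ʳ x) (π ⟨$⟩ʳ y)
  relabel-step⁺ (inj₁ eq)  = inj₁ (cong (π ⟨$⟩ʳ_) eq)
  relabel-step⁺ (inj₂ adj) = inj₂ adj

  relabel-step⁻ : ∀ {x y} → Step G (π ⟨$⟩ʳ x) y → Step (relabel π G) x (π ⟨$⟩ˡ y)
  relabel-step⁻ (inj₁ eq)  = inj₁ (trans (cong (π ⟨$⟩ˡ_) eq) (inverseˡ π))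
  relabel-step⁻ (inj₂ adj) = inj₂ (subst (Adj G _) (sym (inverseʳ π)) adj)

  relabel-connected : Connected G → Connected (relabel π G)
  relabel-connected conn u v =
    subst₂ (Star (Adj (relabel π G))) (inverseˡ π) (inverseˡ π)
           (gmap (π ⟨$⟩ˡ_) unlabel (conn (π ⟨$⟩ʳ u) (π ⟨$⟩ʳ v)))

  relabel-winFrom : ∀ {c : Cops k n} {r} → CopsWinFrom (relabel π G) c r →
                    CopsWinFrom G ((π ⟨$⟩ʳ_) ∘ c) (π ⟨$⟩ʳ r)
  relabel-winFrom (caught (i , eq)) = caught (i , cong (π ⟨$⟩ʳ_) eq)
  relabel-winFrom (move c′ m (inj₁ (i , eq))) =
    move _ (λ j → relabel-step⁺ (m j)) (inj₁ (i , cong (π ⟨$⟩ʳ_) eq))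
  relabel-winFrom (move c′ m (inj₂ w)) =
    move _ (λ j → relabel-step⁺ (m j)) (inj₂ λ r′ s →
      subst (CopsWinFrom G _) (inverseʳ π) (relabel-winFrom (w (π ⟨$⟩ˡ r′) (relabel-step⁻ s))))

  relabel-win : CopsWin (relabel π G) k → CopsWin G k
  relabel-win (c , w) = (π ⟨$⟩ʳ_) ∘ c , λ r →
    subst (CopsWinFrom G _) (inverseʳ π) (relabel-winFrom (w (π ⟨$⟩ˡ r)))

transpose-left : ∀ (i j : Fin n) → transpose i j ⟨$⟩ʳ i ≡ j
transpose-left i j with i ≟ i
... | yes _  = refl
... | no i≢i = contradiction refl i≢i

transpose-right : ∀ (i j : Fin n) → transpose i j ⟨$⟩ʳ j ≡ i
transpose-right i j with j ≟ i
... | yes j≡i = j≡i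
... | no _ with j ≟ j
...   | yes _  = refl
...   | no j≢j = contradiction refl j≢j

transpose-fixed : ∀ {i j x : Fin n} → x ≢ i → x ≢ j → transpose i j ⟨$⟩ʳ x ≡ x
transpose-fixed {i = i} {j} {x} x≢i x≢j with x ≟ i
... | yes x≡i = contradiction x≡i x≢i
... | no _ with x ≟ j
...   | yes x≡j = contradiction x≡j x≢j
...   | no _    = refl

-- Deleting a dominated vertex

module _ (G : Graph (suc n)) {u v : Fin (suc n)} (u≢v : u ≢ v)
         (dom : ∀ w → Adj G u w → Step G v w) where

  delete : Graph n
  delete = record
    { edge   = λ x y → edge G (punchIn u x) (punchIn u y)
    ; sym    = λ x y → Graph.sym G (punchIn u x) (punchIn u y)
    ; irrefl = λ x → irrefl G (punchIn u x)
    }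

  private
    shadow : Fin (suc n) → Fin (suc n)
    shadow w = if does (u ≟ w) then v else w

    shadow-self : shadow u ≡ v
    shadow-self with u ≟ u
    ... | yes _  = refl
    ... | no u≢u = contradiction refl u≢u

    shadow-other : ∀ {w} → u ≢ w → shadow w ≡ w
    shadow-other {w} u≢w with u ≟ w
    ... | yes u≡w = contradiction u≡w u≢w
    ... | no _    = refl

    u≢shadow : ∀ w → u ≢ shadow w
    u≢shadow w with u ≟ w
    ... | yes _  = u≢v
    ... | no u≢w = u≢w

    shadow-step : ∀ {x y} → Step G x y → Step G (shadow x) (shadow y)
    shadow-step {x} (inj₁ refl) = inj₁ refl
    shadow-step {x} {y} (inj₂ adj) with u ≟ x | u ≟ y
    ... | yes refl | yes refl = inj₁ refl
    ... | yes refl | no _     = dom y adj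
    ... | no _     | yes refl = step-sym G (dom x (Graph.sym G x u adj))
    ... | no _     | no _     = inj₂ adj

    fold : Fin (suc n) → Fin n
    fold w = punchOut (u≢shadow w)

    punchIn-fold : ∀ w → punchIn u (fold w) ≡ shadow w
    punchIn-fold w = punchIn-punchOut (u≢shadow w)

    fold-punchIn : ∀ x → fold (punchIn u x) ≡ x
    fold-punchIn x = punchIn-injective u _ _
      (trans (punchIn-fold (punchIn u x)) (shadow-other (≢-sym (punchInᵢ≢i u x))))

    step⁻ : ∀ {x y} → Step G (punchIn u x) (punchIn u y) → Step delete x y
    step⁻ (inj₁ eq)  = inj₁ (punchIn-injective u _ _ eq)
    step⁻ (inj₂ adj) = inj₂ adj

    step⁺ : ∀ {x y} → Step delete x y → Step G (punchIn u x) (punchIn u y)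
    step⁺ (inj₁ eq)  = inj₁ (cong (punchIn u) eq)
    step⁺ (inj₂ adj) = inj₂ adj

    fold-step : ∀ {x y} → Step G x y → Step delete (fold x) (fold y)
    fold-step {x} {y} s =
      step⁻ (subst₂ (Step G) (sym (punchIn-fold x)) (sym (punchIn-fold y)) (shadow-step s))

    -- An edge between `u` and `v` collapses under the retraction and is dropped from the walk.
    fold-walk : ∀ {x y} → Star (Adj G) x y → Star (Adj delete) (fold x) (fold y)
    fold-walk ε = ε
    fold-walk {x} {y} (a ◅ as) with fold-step (inj₂ a)
    ... | inj₁ eq = subst (λ z → Star (Adj delete) z (fold y)) eq (fold-walk as)
    ... | inj₂ b  = b ◅ fold-walk as

  delete-connected : Connected G → Connected delete
  delete-connected conn x y =
    subst₂ (Star (Adj delete)) (fold-punchIn x) (fold-punchIn y)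
           (fold-walk (conn (punchIn u x) (punchIn u y)))

  private
    -- A cop on v pins the robber to u while another cop walks there.
    pin : ∀ {x} → Star (Adj G) x u → (c : Cops k (suc n)) (i j : Fin k) → i ≢ j →
          c i ≡ v → c j ≡ x → CopsWinFrom G c u
    pin ε        c i j i≢j ci≡v cj≡x = caught (j , cj≡x)
    pin (a ◅ as) c i j i≢j ci≡v refl =
      move c′ (moveOne G c j (inj₂ a)) (inj₂ chase)
      where
      c′ = updateAt c j (const _)
      c′i≡v = trans (updateAt-minimal i j c i≢j) ci≡v
      chase : ∀ r′ → Step G u r′ → CopsWinFrom G c′ r′
      chase r′ (inj₁ refl) = pin as c′ i j i≢j c′i≡v (updateAt-updates j c)
      chase r′ (inj₂ adj)  =
        capture G c′ i (subst (λ z → Step G z r′) (sym c′i≡v) (dom r′ adj))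

    other : Fin 2 → Fin 2
    other zero    = suc zero
    other (suc _) = zero

    ≢other : ∀ i → i ≢ other i
    ≢other zero       ()
    ≢other (suc zero) ()

    module _ (conn : Connected G) where

      -- The shadow differs from the robber's place only when he is on `u`. As `u` and `v` need not
      -- be adjacent, the cop on `v` may then be unable to strike, and `pin` takes over.
      onShadow : (c : Cops 2 (suc n)) (i : Fin 2) → ∀ r → c i ≡ shadow r → CopsWinFrom G c r
      onShadow c i r eq with u ≟ r
      ... | yes refl = pin (conn _ u) c i (other i) (≢other i) eq refl
      ... | no _     = caught (i , eq)

      afterShadow : (c : Cops 2 (suc n)) (i : Fin 2) → ∀ {r r′} → c i ≡ shadow r →
                    Step G r r′ → CopsWinFrom G c r′
      afterShadow c i {r} {r′} eq s with u ≟ r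
      ... | no _ = capture G c i (subst (λ z → Step G z r′) (sym eq) s)
      afterShadow c i eq (inj₁ refl) | yes refl =
        onShadow c i _ (trans eq (sym shadow-self))
      afterShadow c i {r′ = r′} eq (inj₂ adj) | yes refl =
        capture G c i (subst (λ z → Step G z r′) (sym eq) (dom _ adj))

      -- The cops copy their moves from the smaller graph, where the robber's image `fold r` moves
      -- legally because the retraction preserves steps.
      lift : ∀ {c : Cops 2 n} {s} → CopsWinFrom delete c s →
             ∀ r → s ≡ fold r → CopsWinFrom G (punchIn u ∘ c) r
      lift {c} (caught (i , eq)) r refl =
        onShadow _ i r (trans (cong (punchIn u) eq) (punchIn-fold r))
      lift (move c′ m (inj₁ (i , eq))) r refl =
        -- The image is caught right after the cops' move, so a robber on `u` may still step away;
        -- `afterShadow` answers that step.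
        move _ (λ j → step⁺ (m j)) (inj₂ λ r′ →
          afterShadow _ i (trans (cong (punchIn u) eq) (punchIn-fold r)))
      lift (move c′ m (inj₂ w)) r refl =
        move _ (λ j → step⁺ (m j)) (inj₂ λ r′ s → lift (w (fold r′) (fold-step s)) r′ refl)

  delete-win : Connected G → CopsWin delete 2 → CopsWin G 2
  delete-win conn (c , w) = punchIn u ∘ c , λ r → lift conn (w (fold r)) r refl

-- Guarding a vertex

cops : Fin n → Fin n → Cops 2 n
cops x y zero    = x
cops x y (suc _) = y

cops-move : (G : Graph n) → ∀ {x x′ y y′} → Step G x x′ → Step G y y′ →
            CopsMove G (cops x y) (cops x′ y′)
cops-move G s t zero    = s
cops-move G s t (suc _) = t

infixl 6 _∖_
_∖_ : List (Fin n) → Fin n → List (Fin n)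
S ∖ u = filter (λ x → ¬? (x ≟ u)) S

Isolated : Graph n → List (Fin n) → Fin n → Set
Isolated G S u = ∀ x → x ∈ S → ¬ Adj G u x

Corner : Graph n → List (Fin n) → Fin n → Set
Corner G S u = ∃ λ w → w ∈ S × Adj G u w × (∀ x → x ∈ S → Adj G u x → Step G w x)

-- The list stands for the subgraph induced on it. Peeling corners shrinks each component to one
-- vertex, which is then isolated and peeled too, so the subgraph may be disconnected.
data Dismantlable (G : Graph n) : List (Fin n) → Set where
  done : Dismantlable G []
  peel : ∀ {S} u → Isolated G S u ⊎ Corner G S u → Dismantlable G (S ∖ u) → Dismantlable G S

module _ (G : Graph n) (conn : Connected G) (v : Fin n) where

  private
    Win : Fin n → Fin n → Set
    Win t r = CopsWinFrom G (cops v t) r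

  -- The robber, while he stays in the territory R, has a shadow f r in S; a cop
  -- that can step onto the shadow is assumed to win. Folding a corner of S keeps this
  -- true for the smaller shadow, and an isolated vertex of S can be walked to.
  dismantle-win : ∀ {S} → Dismantlable G S →
    (R : Fin n → Set) (f : Fin n → Fin n) →
    (∀ r → R r → f r ∈ S) →
    (∀ {r r′} → R r → R r′ → Step G r r′ → Step G (f r) (f r′)) →
    (∀ {r r′} → R r → Step G r r′ → R r′ ⊎ (∀ t → Win t r′)) →
    (∀ {r t} → R r → Step G t (f r) → Win t r) →
    ∀ {r} → R r → ∀ t → Win t r
  dismantle-win done R f f∈S f-step stay win Rr = contradiction (f∈S _ Rr) λ ()
  dismantle-win {S} (peel u (inj₂ (w , w∈S , u~w , dom)) D) R f f∈S f-step stay win =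
    dismantle-win D R (λ r → g (f r)) (λ r Rr → g∈ (f∈S r Rr))
      (λ Rr Rr′ s → g-step (f∈S _ Rr) (f∈S _ Rr′) (f-step Rr Rr′ s)) stay win′
    where
    w≢u : w ≢ u
    w≢u refl = irrefl G w u~w

    g : Fin n → Fin n
    g x = if does (x ≟ u) then w else x

    g∈ : ∀ {x} → x ∈ S → g x ∈ S ∖ u
    g∈ {x} x∈S with x ≟ u
    ... | yes _  = ∈-filter⁺ (λ x → ¬? (x ≟ u)) w∈S w≢u
    ... | no x≢u = ∈-filter⁺ (λ x → ¬? (x ≟ u)) x∈S x≢u

    ahead : ∀ {x y} → y ∈ S → Step G x y → Step G (g x) y
    ahead {x} y∈S s with x ≟ u
    ... | no _ = s
    ahead y∈S (inj₁ refl) | yes refl = inj₂ (Graph.sym G _ _ u~w)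
    ahead y∈S (inj₂ adj)  | yes refl = dom _ y∈S adj

    g-step : ∀ {x y} → x ∈ S → y ∈ S → Step G x y → Step G (g x) (g y)
    g-step {x} {y} x∈S y∈S s with y ≟ u
    ... | no _ = ahead y∈S s
    g-step {x} x∈S y∈S s | yes refl with x ≟ u
    ... | yes _ = inj₁ refl
    g-step x∈S y∈S (inj₁ refl) | yes refl | no u≢u = contradiction refl u≢u
    g-step x∈S y∈S (inj₂ adj)  | yes refl | no _   =
      step-sym G (dom _ x∈S (Graph.sym G _ _ adj))

    win′ : ∀ {r t} → R r → Step G t (g (f r)) → Win t r
    -- The cop first steps onto the smaller shadow. After the robber's reply, `ahead` lets it step
    -- onto the larger one, since `w` reaches all of `S` that `u` reaches; this is what `win` asks
    -- for.
    win′ {r} Rr s = move _ (cops-move G (inj₁ refl) s) (inj₂ λ r′ s′ → next r′ s′ (stay Rr s′))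
      where
      next : ∀ r′ → Step G r r′ → R r′ ⊎ (∀ t → Win t r′) → Win (g (f r)) r′
      next r′ s′ (inj₁ Rr′) = win Rr′ (ahead (f∈S _ Rr′) (f-step Rr Rr′ s′))
      next r′ s′ (inj₂ w′)  = w′ _
  dismantle-win {S} (peel u (inj₁ iso) D) R f f∈S f-step stay win {r₀} Rr₀ with f r₀ ≟ u
  -- The shadow cannot leave the isolated vertex `u` while the robber stays in `R`, so the second
  -- cop has time to walk there.
  ... | yes fr≡u = λ t → walk (conn t u) Rr₀ fr≡u
    where
    walk : ∀ {t r} → Star (Adj G) t u → R r → f r ≡ u → Win t r
    walk ε        Rr fr≡u = win Rr (inj₁ fr≡u)
    walk {r = r} (a ◅ as) Rr fr≡u =
      move _ (cops-move G (inj₁ refl) (inj₂ a)) (inj₂ λ r′ s → next r′ s (stay Rr s))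
      where
      next : ∀ r′ → Step G r r′ → R r′ ⊎ (∀ t → Win t r′) → Win _ r′
      next r′ s (inj₂ w′)  = w′ _
      next r′ s (inj₁ Rr′) with f-step Rr Rr′ s
      ... | inj₁ eq  = walk as Rr′ (trans eq fr≡u)
      ... | inj₂ adj = contradiction (subst (λ z → Adj G z (f r′)) fr≡u adj) (iso _ (f∈S _ Rr′))
  ... | no fr≢u =
    -- A shadow off `u` can never enter `u`, so `f` is kept and only the territory shrinks.
    dismantle-win D (λ r → R r × f r ≢ u) f
      (λ r (Rr , fr≢u) → ∈-filter⁺ (λ x → ¬? (x ≟ u)) (f∈S r Rr) fr≢u)
      (λ (Rr , _) (Rr′ , _) → f-step Rr Rr′)
      stay′ (λ (Rr , _) → win Rr) (Rr₀ , fr≢u)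
    where
    stay′ : ∀ {r r′} → R r × f r ≢ u → Step G r r′ → (R r′ × f r′ ≢ u) ⊎ (∀ t → Win t r′)
    stay′ {r} {r′} (Rr , fr≢u) s with stay Rr s
    ... | inj₂ w′  = inj₂ w′
    ... | inj₁ Rr′ = inj₁ (Rr′ , leaves)
      where
      leaves : f r′ ≢ u
      leaves refl with f-step Rr Rr′ s
      ... | inj₁ eq  = fr≢u (sym eq)
      ... | inj₂ adj = iso _ (f∈S _ Rr) (Graph.sym G _ _ adj)

  -- The cop on `v` captures a robber who steps out of `S`, so `S` serves as territory and the first
  -- shadow is the identity.
  guard-win : ∀ {S} → Dismantlable G S → (∀ r → r ∈ S ⊎ Step G v r) → CopsWin G 2
  guard-win {S} D cover = cops v v , λ r → [ (λ r∈S → inS r∈S v) , capture G _ zero ]′ (cover r)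
    where
    inS : ∀ {r} → r ∈ S → ∀ t → Win t r
    inS = dismantle-win D (_∈ S) (λ r → r) (λ _ r∈S → r∈S) (λ _ _ s → s)
      (λ {r} {r′} _ _ → [ inj₁ , (λ s → inj₂ λ t → capture G (cops v t) zero s) ]′ (cover r′))
      (λ _ s → capture G _ (suc zero) s)

-- Degrees

count : (Fin n → Bool) → ℕ
count b = sum (λ x → if b x then 1 else 0)

count-mono : (a b : Fin n → Bool) → (∀ x → T (a x) → T (b x)) → count a ≤ count b
count-mono {zero}  a b a⇒b = z≤n
count-mono {suc n} a b a⇒b =
  +-mono-≤ (head (a zero) (b zero) (a⇒b zero)) (count-mono (a ∘ suc) (b ∘ suc) (a⇒b ∘ suc))
  where
  head : ∀ p q → (T p → T q) → (if p then 1 else 0) ≤ (if q then 1 else 0)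
  head false q     p⇒q = z≤n
  head true  true  p⇒q = ≤-refl
  head true  false p⇒q = contradiction _ p⇒q

degree : Graph n → Fin n → ℕ
degree G x = count (edge G x)

relabel-degree : (π : Permutation′ n) (G : Graph n) → ∀ x →
                 degree (relabel π G) x ≡ degree G (π ⟨$⟩ʳ x)
relabel-degree π G x = sym (sum-permute (λ y → if edge G (π ⟨$⟩ʳ x) y then 1 else 0) π)

MaxDegree₀ : Graph (suc n) → Set
MaxDegree₀ G = ∀ x → degree G x ≤ degree G zero

relabel-maxDegree : (π : Permutation′ (suc n)) (G : Graph (suc n)) →
  (∀ x → degree G x ≤ degree G (π ⟨$⟩ʳ zero)) → MaxDegree₀ (relabel π G)
relabel-maxDegree π G max x =
  subst₂ _≤_ (sym (relabel-degree π G x)) (sym (relabel-degree π G zero)) (max (π ⟨$⟩ʳ x))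

-- Partial graphs

-- An entry is nothing as long as the edge is undecided.
PartialGraph : ℕ → Set
PartialGraph n = Vec (Vec (Maybe Bool) n) n

infix 8 _[_,_]
_[_,_] : PartialGraph n → Fin n → Fin n → Maybe Bool
p [ x , y ] = lookup (lookup p x) y

Consistent : Graph n → PartialGraph n → Set
Consistent G p = ∀ x y {b} → p [ x , y ] ≡ just b → edge G x y ≡ b

infix 4 _≟ᵐ_
_≟ᵐ_ : (a b : Maybe Bool) → Dec (a ≡ b)
_≟ᵐ_ = ≡-dec Bool._≟_

isSure : Maybe Bool → Bool
isSure (just true) = true
isSure _           = false

isPossible : Maybe Bool → Bool
isPossible (just false) = false
isPossible _            = true

Sure : PartialGraph n → Fin n → Fin n → Set
Sure p x y = T (isSure (p [ x , y ]))

sure? : (p : PartialGraph n) → ∀ x y → Dec (Sure p x y)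
sure? p x y = T? (isSure (p [ x , y ]))

Possible : PartialGraph n → Fin n → Fin n → Set
Possible p x y = T (isPossible (p [ x , y ]))

possible? : (p : PartialGraph n) → ∀ x y → Dec (Possible p x y)
possible? p x y = T? (isPossible (p [ x , y ]))

SureStep : PartialGraph n → Fin n → Fin n → Set
SureStep p x y = y ≡ x ⊎ Sure p x y

sureStep? : (p : PartialGraph n) → ∀ x y → Dec (SureStep p x y)
sureStep? p x y = (y ≟ x) ⊎-dec sure? p x y

PossibleStep : PartialGraph n → Fin n → Fin n → Set
PossibleStep p x y = y ≡ x ⊎ Possible p x y

possibleStep? : (p : PartialGraph n) → ∀ x y → Dec (PossibleStep p x y)
possibleStep? p x y = (y ≟ x) ⊎-dec possible? p x y

module _ (G : Graph n) (p : PartialGraph n) (cons : Consistent G p) where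

  sure⇒adj : ∀ {x y} → Sure p x y → Adj G x y
  sure⇒adj {x} {y} s with p [ x , y ] in eq
  ... | just true = subst T (sym (cons x y eq)) _

  adj⇒possible : ∀ {x y} → Adj G x y → Possible p x y
  adj⇒possible {x} {y} adj with p [ x , y ] in eq
  ... | just true  = _
  ... | nothing    = _
  ... | just false = subst T (cons x y eq) adj

  sureStep⇒step : ∀ {x y} → SureStep p x y → Step G x y
  sureStep⇒step (inj₁ eq) = inj₁ eq
  sureStep⇒step (inj₂ s)  = inj₂ (sure⇒adj s)

  step⇒possibleStep : ∀ {x y} → Step G x y → PossibleStep p x y
  step⇒possibleStep (inj₁ eq)  = inj₁ eq
  step⇒possibleStep (inj₂ adj) = inj₂ (adj⇒possible adj)

table : (Fin n → Fin n → Maybe Bool) → PartialGraph n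
table f = tabulate λ x → tabulate (f x)

lookup-table : (f : Fin n → Fin n → Maybe Bool) → ∀ x y → table f [ x , y ] ≡ f x y
lookup-table f x y = trans (cong (λ row → lookup row y) (lookup∘tabulate (λ x → tabulate (f x)) x))
                           (lookup∘tabulate (f x) y)

blank : PartialGraph n
blank = table λ x y → if does (x ≟ y) then just false else nothing

blank-consistent : (G : Graph n) → Consistent G blank
blank-consistent G x y {b} eq = go (trans (sym (lookup-table _ x y)) eq)
  where
  go : (if does (x ≟ y) then just false else nothing) ≡ just b → edge G x y ≡ b
  go eq with x ≟ y
  go refl | yes refl = edge-irrefl G x

-- A whole set `Y` of endpoints is treated at once because the negative branch of a split rules out
-- a class of exchangeable vertices.
assign : PartialGraph n → Bool → Fin n → (Fin n → Bool) → PartialGraph n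
assign p b i Y = table λ x y →
  if (does (x ≟ i) ∧ Y y) ∨ (does (y ≟ i) ∧ Y x) then just b else p [ x , y ]

assign-consistent : (G : Graph n) (p : PartialGraph n) → Consistent G p →
  ∀ b i Y → (∀ y → T (Y y) → edge G i y ≡ b) → Consistent G (assign p b i Y)
assign-consistent G p cons b i Y Y⇒b x y {b′} eq = go (trans (sym (lookup-table _ x y)) eq)
  where
  backward : (if does (y ≟ i) ∧ Y x then just b else p [ x , y ]) ≡ just b′ → edge G x y ≡ b′
  backward eq with y ≟ i
  ... | no _ = cons x y eq
  ... | yes refl with Y x in Yx
  ...   | false = cons x y eq
  backward refl | yes refl | true = trans (edge-comm G x i) (Y⇒b x (subst T (sym Yx) _))

  go : (if (does (x ≟ i) ∧ Y y) ∨ (does (y ≟ i) ∧ Y x) then just b else p [ x , y ]) ≡ just b′ →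
       edge G x y ≡ b′
  go eq with x ≟ i
  ... | no _ = backward eq
  ... | yes refl with Y y in Yy
  ...   | false = backward eq
  go refl | yes refl | true = Y⇒b y (subst T (sym Yy) _)

-- Ways to settle a partial graph

-- Contradicts maximality at vertex 0: the first count bounds its degree from above, the second
-- bounds the degree of `x` from below.
Overfull : PartialGraph (suc n) → Set
Overfull p = ∃ λ x → count (λ y → does (possible? p zero y)) < count (λ y → does (sure? p x y))

-- Here and below, edges assumed are only possible and edges concluded are sure, so the property
-- passes to every consistent graph.
Dominated : PartialGraph n → Set
Dominated p = ∃₂ λ u v → u ≢ v × (∀ w → Possible p u w → SureStep p v w)

Removable : PartialGraph n → List (Fin n) → Fin n → Set
Removable p S u =
  All.All (λ x → ¬ Possible p u x) S ⊎
  Any.Any (λ w → Sure p u w × All.All (λ x → Possible p u x → SureStep p w x) S) S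

removable? : (p : PartialGraph n) → ∀ S u → Dec (Removable p S u)
removable? p S u =
  All.all? (λ x → ¬? (possible? p u x)) S ⊎-dec
  Any.any? (λ w → sure? p u w ×-dec All.all? (λ x → possible? p u x →-dec sureStep? p w x) S) S

mutual
  -- Greedy, without backtracking. `PeelableAt` carries `Removable` for the vertex found, so
  -- soundness uses no property of `List.find`.
  Peelable : ℕ → PartialGraph n → List (Fin n) → Set
  Peelable k       p []         = ⊤
  Peelable zero    p S@(_ ∷ _)  = ⊥
  Peelable (suc k) p S@(_ ∷ _)  = PeelableAt k p S (List.find (removable? p S) S)

  PeelableAt : ℕ → PartialGraph n → List (Fin n) → Maybe (Fin n) → Set
  PeelableAt k p S nothing  = ⊥
  PeelableAt k p S (just u) = Removable p S u × Peelable k p (S ∖ u)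

mutual
  peelable? : ∀ k (p : PartialGraph n) S → Dec (Peelable k p S)
  peelable? zero    p []        = yes tt
  peelable? (suc k) p []        = yes tt
  peelable? zero    p (_ ∷ _)   = no λ ()
  peelable? (suc k) p S@(_ ∷ _) = peelableAt? k p S (List.find (removable? p S) S)

  peelableAt? : ∀ k (p : PartialGraph n) S m → Dec (PeelableAt k p S m)
  peelableAt? k p S nothing  = no λ ()
  peelableAt? k p S (just u) = removable? p S u ×-dec peelable? k p (S ∖ u)

-- An upper bound for V - N[v]: vertices whose edge to `v` is undecided are kept.
far : PartialGraph n → Fin n → List (Fin n)
far p v = filter (λ x → ¬? (sureStep? p v x)) (allFin _)

Guardable : PartialGraph n → Set
Guardable {n} p = ∃ λ v → Peelable n p (far p v)

-- The cops strike at once, or make one move after which every reply of the robber is within reach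
-- of one of them.
Trappable : PartialGraph n → Set
Trappable p = ∃₂ λ a b → ∀ r → SureStep p a r ⊎ SureStep p b r ⊎
  ∃₂ λ a′ b′ → SureStep p a a′ × SureStep p b b′ ×
    (∀ r′ → PossibleStep p r r′ → SureStep p a′ r′ ⊎ SureStep p b′ r′)

-- The transposition of `j` and `j′` then respects `p`. Entries among `j` and `j′` are exempt:
-- symmetry and irreflexivity of the graph handle them.
Twins : PartialGraph n → Fin n → Fin n → Set
Twins p j j′ = ∀ x → x ≡ j ⊎ x ≡ j′ ⊎ (p [ j , x ] ≡ p [ j′ , x ] × p [ x , j ] ≡ p [ x , j′ ])

-- Vertex 0 is never exchanged, so it keeps its maximum degree.
Exchangeable : PartialGraph (suc n) → Fin (suc n) → Fin (suc n) → Fin (suc n) → Set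
Exchangeable p i j j′ = (zero ≢ j × zero ≢ j′ × i ≢ j × i ≢ j′) × Twins p j j′

exchangeable? : (p : PartialGraph (suc n)) → ∀ i j j′ → Dec (Exchangeable p i j j′)
exchangeable? p i j j′ =
  (¬? (zero ≟ j) ×-dec ¬? (zero ≟ j′) ×-dec ¬? (i ≟ j) ×-dec ¬? (i ≟ j′)) ×-dec
  all? λ x → (x ≟ j) ⊎-dec (x ≟ j′) ⊎-dec
    ((p [ j , x ] ≟ᵐ p [ j′ , x ]) ×-dec (p [ x , j ] ≟ᵐ p [ x , j′ ]))

-- Deciding the edges inside V − N[0] first keeps the search small.
choose : PartialGraph (suc n) → Maybe (Fin (suc n) × Fin (suc n))
choose {n} p = List.find (λ (i , j) → p [ i , j ] ≟ᵐ nothing)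
  -- Once row 0 is decided, `R` is exactly V - N[0]. The last product is exhaustive, so `nothing`
  -- means that no edge is open.
  (cartesianProduct (zero ∷ []) (allFin _) ++ cartesianProduct R R ++
   cartesianProduct R (allFin _) ++ cartesianProduct (allFin _) (allFin _))
  where
  R = far p zero

-- The search tree

mutual
  Settled : ℕ → PartialGraph (suc n) → Set
  Settled zero    p = ⊥
  Settled (suc k) p = Overfull p ⊎ Dominated p ⊎ Guardable p ⊎ Split k p (choose p)

  Split : ℕ → PartialGraph (suc n) → Maybe (Fin (suc n) × Fin (suc n)) → Set
  Split k p nothing        = Trappable p
  -- If i has a neighbour exchangeable with j, exchange the two; otherwise i has no such neighbour.
  Split k p (just (i , j)) =
    Settled k (assign p true i (λ y → does (y ≟ j))) ×
    Settled k (assign p false i (λ y → does (exchangeable? p i j y)))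

mutual
  settled? : ∀ k (p : PartialGraph (suc n)) → Dec (Settled k p)
  settled? zero    p = no λ ()
  settled? {n} (suc k) p =
    any? (λ x → count (λ y → does (possible? p zero y)) <? count (λ y → does (sure? p x y))) ⊎-dec
    any? (λ u → any? λ v → ¬? (u ≟ v) ×-dec all? λ w → possible? p u w →-dec sureStep? p v w) ⊎-dec
    any? (λ v → peelable? (suc n) p (far p v)) ⊎-dec
    split? k p (choose p)

  split? : ∀ k (p : PartialGraph (suc n)) m → Dec (Split k p m)
  split? k p nothing = any? λ a → any? λ b → all? λ r →
    sureStep? p a r ⊎-dec sureStep? p b r ⊎-dec
    any? λ a′ → any? λ b′ → sureStep? p a a′ ×-dec sureStep? p b b′ ×-dec
      all? λ r′ → possibleStep? p r r′ →-dec (sureStep? p a′ r′ ⊎-dec sureStep? p b′ r′)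
  split? k p (just (i , j)) =
    settled? k (assign p true i (λ y → does (y ≟ j))) ×-dec
    settled? k (assign p false i (λ y → does (exchangeable? p i j y)))

-- The vertex is there to exclude the empty graph.
TwoCopsWin : ℕ → Set
TwoCopsWin n = (G : Graph n) → Connected G → Fin n → CopsWin G 2

-- Soundness of the criteria

dominated-win : TwoCopsWin n →
  (G : Graph (suc n)) → Connected G → ∀ p → Consistent G p → Dominated p → CopsWin G 2
dominated-win smaller G conn p cons (u , v , u≢v , dom) =
  delete-win G u≢v dom′ conn
    -- `punchOut u≢v` is `v` seen in G - u, which is therefore nonempty.
    (smaller (delete G u≢v dom′) (delete-connected G u≢v dom′ conn) (punchOut u≢v))
  where
  dom′ : ∀ w → Adj G u w → Step G v w
  dom′ w adj = sureStep⇒step G p cons (dom w (adj⇒possible G p cons adj))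

peelable⇒dismantlable : (G : Graph n) → ∀ p → Consistent G p →
  ∀ k S → Peelable k p S → Dismantlable G S
peelable⇒dismantlable G p cons k [] _ = done
peelable⇒dismantlable G p cons (suc k) S@(_ ∷ _) pl with List.find (removable? p S) S
... | just u = peel u (removable (proj₁ pl)) (peelable⇒dismantlable G p cons k (S ∖ u) (proj₂ pl))
  where
  removable : Removable p S u → Isolated G S u ⊎ Corner G S u
  removable (inj₁ iso) = inj₁ λ x x∈S adj → All.lookup iso x∈S (adj⇒possible G p cons adj)
  removable (inj₂ corner) with find corner
  ... | w , w∈S , u~w , dom = inj₂ (w , w∈S , sure⇒adj G p cons u~w , λ x x∈S adj →
          sureStep⇒step G p cons (All.lookup dom x∈S (adj⇒possible G p cons adj)))

guardable-win : (G : Graph n) → Connected G → ∀ p → Consistent G p → Guardable p → CopsWin G 2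
guardable-win G conn p cons (v , pl) =
  guard-win G conn v (peelable⇒dismantlable G p cons _ _ pl) cover
  where
  cover : ∀ r → r ∈ far p v ⊎ Step G v r
  cover r with sureStep? p v r
  ... | yes s = inj₂ (sureStep⇒step G p cons s)
  ... | no ¬s = inj₁ (∈-filter⁺ (λ x → ¬? (sureStep? p v x)) (∈-allFin r) ¬s)

trappable-win : (G : Graph n) → ∀ p → Consistent G p → Trappable p → CopsWin G 2
trappable-win G p cons (a , b , trap) = cops a b , λ r → go r (trap r)
  where
  step : ∀ {x y} → SureStep p x y → Step G x y
  step = sureStep⇒step G p cons

  strike : ∀ {x y r} → SureStep p x r ⊎ SureStep p y r → CopsWinFrom G (cops x y) r
  strike (inj₁ s) = capture G _ zero (step s)
  strike (inj₂ s) = capture G _ (suc zero) (step s)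

  go : ∀ r → _ → CopsWinFrom G (cops a b) r
  go r (inj₁ s)        = strike (inj₁ s)
  go r (inj₂ (inj₁ s)) = strike (inj₂ s)
  go r (inj₂ (inj₂ (a′ , b′ , s , t , all))) =
    move (cops a′ b′) (cops-move G (step s) (step t))
         (inj₂ λ r′ s′ → strike (all r′ (step⇒possibleStep G p cons s′)))

overfull-absurd : (G : Graph (suc n)) → MaxDegree₀ G → ∀ p → Consistent G p → ¬ Overfull p
overfull-absurd G max p cons (x , few<many) = <⇒≱ few<many
  (≤-trans (count-mono _ _ λ y → sure⇒adj G p cons {x} {y})
  (≤-trans (max x)
           (count-mono _ _ λ y → adj⇒possible G p cons {zero} {y})))

-- Exchanging twins

module _ (G : Graph n) (p : PartialGraph n) (cons : Consistent G p)
         {j j′ : Fin n} (tw : Twins p j j′) where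

  private
    -- The graph of the transposition as a relation, so that edges can be treated by matching on
    -- both endpoints.
    data Swapped : Fin n → Fin n → Set where
      left  : Swapped j j′
      right : Swapped j′ j
      fixed : ∀ {x} → p [ j , x ] ≡ p [ j′ , x ] → p [ x , j ] ≡ p [ x , j′ ] → Swapped x x

    swapped : ∀ x → Swapped x (transpose j j′ ⟨$⟩ʳ x)
    swapped x = go (x ≟ j) (x ≟ j′) (tw x)
      where
      go : Dec (x ≡ j) → Dec (x ≡ j′) → _ → Swapped x (transpose j j′ ⟨$⟩ʳ x)
      go (yes refl) _          _ = subst (Swapped j) (sym (transpose-left j j′)) left
      go (no _)     (yes refl) _ = subst (Swapped j′) (sym (transpose-right j j′)) right
      go (no x≢j)   (no x≢j′)  (inj₁ x≡j)         = contradiction x≡j x≢j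
      go (no x≢j)   (no x≢j′)  (inj₂ (inj₁ x≡j′)) = contradiction x≡j′ x≢j′
      go (no x≢j)   (no x≢j′)  (inj₂ (inj₂ (row , col))) =
        subst (Swapped x) (sym (transpose-fixed x≢j x≢j′)) (fixed row col)

    loop : ∀ {x y b} → p [ x , x ] ≡ just b → edge G y y ≡ b
    loop {x} {y} eq = trans (trans (edge-irrefl G y) (sym (edge-irrefl G x))) (cons x x eq)

    swapped-edge : ∀ {x x′ y y′ b} → Swapped x x′ → Swapped y y′ →
                   p [ x , y ] ≡ just b → edge G x′ y′ ≡ b
    swapped-edge left          left          eq = loop eq
    swapped-edge left          right         eq = trans (edge-comm G j′ j) (cons j j′ eq)
    swapped-edge left          (fixed row _) eq = cons _ _ (trans (sym row) eq)
    swapped-edge right         left          eq = trans (edge-comm G j j′) (cons j′ j eq)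
    swapped-edge right         right         eq = loop eq
    swapped-edge right         (fixed row _) eq = cons _ _ (trans row eq)
    swapped-edge (fixed _ col) left          eq = cons _ _ (trans (sym col) eq)
    swapped-edge (fixed _ col) right         eq = cons _ _ (trans col eq)
    swapped-edge (fixed _ _)   (fixed _ _)   eq = cons _ _ eq

  twins-consistent : Consistent (relabel (transpose j j′) G) p
  twins-consistent x y = swapped-edge (swapped x) (swapped y)

-- Soundness of the search

module _ (smaller : TwoCopsWin n) where

  -- Induction on the search tree. `G` is quantified after the certificate because the positive
  -- branch continues with a relabelled graph.
  settled-win : ∀ k (p : PartialGraph (suc n)) → Settled k p →
    (G : Graph (suc n)) → Connected G → MaxDegree₀ G → Consistent G p → CopsWin G 2
  settled-win (suc k) p (inj₁ over) G conn max cons =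
    contradiction over (overfull-absurd G max p cons)
  settled-win (suc k) p (inj₂ (inj₁ dom)) G conn max cons =
    dominated-win smaller G conn p cons dom
  settled-win (suc k) p (inj₂ (inj₂ (inj₁ guard))) G conn max cons =
    guardable-win G conn p cons guard
  settled-win (suc k) p (inj₂ (inj₂ (inj₂ sp))) G conn max cons with choose p
  ... | nothing = trappable-win G p cons sp
  ... | just (i , j)
    -- `y` may be `j` itself; the exchange is then the identity.
    with any? (λ y → exchangeable? p i j y ×-dec (edge G i y Bool.≟ true))
  ...   | yes (y , ((0≢j , 0≢y , i≢j , i≢y) , tw) , i~y) =
    -- The exchange fixes 0 and `i` and gives the neighbour `y` the name `j`, so maximality at 0
    -- survives and the edge from `i` to `j` is present.
    relabel-win π G (settled-win k _ (proj₁ sp) (relabel π G) (relabel-connected π G conn)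
      (relabel-maxDegree π G λ x →
        subst (λ z → degree G x ≤ degree G z) (sym (transpose-fixed 0≢j 0≢y)) (max x))
      (assign-consistent (relabel π G) p (twins-consistent G p cons tw) true i _ i~j))
    where
    π = transpose j y

    i~j : ∀ z → T (does (z ≟ j)) → edge G (π ⟨$⟩ʳ i) (π ⟨$⟩ʳ z) ≡ true
    i~j z z=j with refl ← witness (z ≟ j) z=j =
      trans (cong₂ (edge G) (transpose-fixed i≢j i≢y) (transpose-left z y)) i~y
  ...   | no none =
    settled-win k _ (proj₂ sp) G conn max (assign-consistent G p cons false i _ i≁)
    where
    i≁ : ∀ z → T (does (exchangeable? p i j z)) → edge G i z ≡ false
    i≁ z ex = Bool.¬-not λ i~z → none (z , witness (exchangeable? p i j z) ex , i~z)

-- Running the search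

maximum : (f : Fin (suc n) → ℕ) → ∃ λ m → ∀ x → f x ≤ f m
maximum {n} f = argmax f zero (allFin _) , λ x →
  All.lookup (f[xs]≤f[argmax] {f = f} zero (allFin (suc n))) (∈-allFin x)

-- With blank in place of the variable p, checking the body would unfold the search.
relabel-settled-win : TwoCopsWin n →
  ∀ k (p : PartialGraph (suc n)) → does (settled? k p) ≡ true →
  (∀ G → Consistent G p) → TwoCopsWin (suc n)
relabel-settled-win smaller k p settled cons G conn _ =
  relabel-win π G
    (settled-win smaller k p (witness (settled? k p) (subst T (sym settled) _))
      (relabel π G) (relabel-connected π G conn)
      (relabel-maxDegree π G λ x →
        subst (λ z → degree G x ≤ degree G z) (sym (transpose-left zero m)) (max x))
      (cons (relabel π G)))
  where
  m   = proj₁ (maximum (degree G))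
  max = proj₂ (maximum (degree G))
  -- Gives a vertex of maximum degree the name 0.
  π   = transpose zero m

-- The search enters as a Boolean equation, so that `refl` proves it by evaluation.
extend : ∀ k → TwoCopsWin n → does (settled? {n} k blank) ≡ true → TwoCopsWin (suc n)
extend {n} k smaller settled =
  relabel-settled-win smaller k (blank {suc n}) settled blank-consistent

-- 37 is enough fuel: every split decides one of at most 36 edges.
twoCopsWin : ∀ n → n ≤ 9 → TwoCopsWin n
twoCopsWin 0 _ G conn ()
twoCopsWin 1 n≤9 = extend 37 (twoCopsWin 0 (<⇒≤ n≤9)) refl
twoCopsWin 2 n≤9 = extend 37 (twoCopsWin 1 (<⇒≤ n≤9)) refl
twoCopsWin 3 n≤9 = extend 37 (twoCopsWin 2 (<⇒≤ n≤9)) refl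
twoCopsWin 4 n≤9 = extend 37 (twoCopsWin 3 (<⇒≤ n≤9)) refl
twoCopsWin 5 n≤9 = extend 37 (twoCopsWin 4 (<⇒≤ n≤9)) refl
twoCopsWin 6 n≤9 = extend 37 (twoCopsWin 5 (<⇒≤ n≤9)) refl
twoCopsWin 7 n≤9 = extend 37 (twoCopsWin 6 (<⇒≤ n≤9)) refl
twoCopsWin 8 n≤9 = extend 37 (twoCopsWin 7 (<⇒≤ n≤9)) refl
twoCopsWin 9 n≤9 = extend 37 (twoCopsWin 8 (<⇒≤ n≤9)) refl
twoCopsWin (suc (suc (suc (suc (suc (suc (suc (suc (suc (suc n))))))))))
  (s≤s (s≤s (s≤s (s≤s (s≤s (s≤s (s≤s (s≤s (s≤s ())))))))))

theorem1 : (n : ℕ) → 1 ≤ n → n ≤ 9 → (G : Graph n) → Connected G → CopNumber≤ G 2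
theorem1 (suc n) _ n≤9 G conn = 2 , ≤-refl , twoCopsWin (suc n) n≤9 G conn zero
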